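{- For every $n\ge 3$, the local metric dimension of the convex polytope graph $U_n$ is $lmd(U_n)=2$.
   Context: For $n\ge 3$, $U_n$ is the graph with vertex set $\{a_i,b_i,c_i,d_i,e_i : 1\le i\le n\}$ and edge set $\{a_ia_{i+1}, b_ib_{i+1}, e_ie_{i+1}, a_ib_i, b_ic_i, c_id_i, d_ie_i, c_{i+1}d_i : 1\le i\le n\}$, indices taken modulo $n$. A vertex $w$ resolves $u,v$ if $d(u,w)\neq d(v,w)$ ($d$ the graph distance). A set $W$ is a local resolving set if every two adjacent vertices are resolved by some element of $W$; $lmd(G)$ is the minimum cardinality of a local resolving set of $G$. -}

module Defs where

open import Data.Fin.Base using (Fin; toℕ)
open import Data.Fin.Properties using (nonZeroIndex; toℕ<n; toℕ-fromℕ<)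
open import Data.List.Base using (List; length)
open import Data.List.Membership.Propositional using (_∈_)
open import Data.List.Relation.Unary.Unique.Propositional using (Unique)
open import Data.Nat.Base using (ℕ; suc; _≤_)
open import Data.Nat.DivMod using (_mod_; _%_; m%n<n; m<n⇒m%n≡m; n%n≡0)
open import Data.Nat.Properties using (m≤n⇒m<n∨m≡n; 1+n≢n; <-irrefl; ≤-trans; n≤1+n)
open import Data.Product.Base using (Σ-syntax; ∃-syntax; _×_)
open import Data.Sum.Base using (inj₁; inj₂)
open import Relation.Binary.Construct.Closure.Symmetric using (SymClosure; fwd; bwd; symmetric)
open import Relation.Binary.Definitions using (Symmetric)
open import Relation.Binary.PropositionalEquality using (_≡_; _≢_; refl; sym; trans; cong)
open import Relation.Nullary.Negation using (¬_)

record SimpleGraph : Set₁ where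
  field
    Vertex     : Set
    Adj        : Vertex → Vertex → Set
    Adj-sym    : Symmetric Adj
    Adj-irrefl : ∀ {u} → ¬ Adj u u

module _ (G : SimpleGraph) where
  open SimpleGraph G

  data Walk : Vertex → Vertex → ℕ → Set where
    nil  : ∀ {u} → Walk u u 0
    cons : ∀ {u v w k} → Adj u v → Walk v w k → Walk u w (suc k)

  -- The graph distance d(u , v) = k, as a functional relation; u and v have
  -- no distance when they lie in different components.
  Distance : Vertex → Vertex → ℕ → Set
  Distance u v k = Walk u v k × (∀ {l} → Walk u v l → k ≤ l)

  Resolves : Vertex → Vertex → Vertex → Set
  Resolves w u v = ∃[ k ] ∃[ l ] (Distance u w k × Distance v w l × k ≢ l)

  -- Finite vertex sets are lists; cardinality is `length` on `Unique` lists.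
  IsLocalResolvingSet : List Vertex → Set
  IsLocalResolvingSet W = ∀ {u v} → Adj u v → ∃[ w ] (w ∈ W × Resolves w u v)

  -- lmd(G) = k.
  LocalMetricDimension : ℕ → Set
  LocalMetricDimension k =
    (Σ[ W ∈ List Vertex ] (Unique W × IsLocalResolvingSet W × length W ≡ k))
    × (∀ W → Unique W → IsLocalResolvingSet W → k ≤ length W)

-- Indices 1, …, n modulo n are represented by Fin n = {0, …, n - 1};
-- `next` is i ↦ i + 1 mod n.
next : ∀ {n} → Fin n → Fin n
next {n} i = _mod_ (suc (toℕ i)) n {{nonZeroIndex i}}

data UVertex (n : ℕ) : Set where
  a b c d e : Fin n → UVertex n

data UEdge {n : ℕ} : UVertex n → UVertex n → Set where
  aa  : ∀ i → UEdge (a i) (a (next i))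
  bb  : ∀ i → UEdge (b i) (b (next i))
  ee  : ∀ i → UEdge (e i) (e (next i))
  ab  : ∀ i → UEdge (a i) (b i)
  bc  : ∀ i → UEdge (b i) (c i)
  cd  : ∀ i → UEdge (c i) (d i)
  de  : ∀ i → UEdge (d i) (e i)
  c⁺d : ∀ i → UEdge (c (next i)) (d i)

next-≢ : ∀ {n} → 2 ≤ n → (i : Fin n) → next i ≢ i
next-≢ {suc m} 2≤n i eq with m≤n⇒m<n∨m≡n (toℕ<n i)
... | inj₁ si<n = 1+n≢n (trans (sym (m<n⇒m%n≡m si<n)) toℕ-eq)
  where
  toℕ-eq : suc (toℕ i) % suc m ≡ toℕ i
  toℕ-eq = trans (sym (toℕ-fromℕ< (m%n<n (suc (toℕ i)) (suc m)))) (cong toℕ eq)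
... | inj₂ si≡n = <-irrefl (trans (cong suc 0≡i) si≡n) 2≤n
  where
  toℕ-eq : suc (toℕ i) % suc m ≡ toℕ i
  toℕ-eq = trans (sym (toℕ-fromℕ< (m%n<n (suc (toℕ i)) (suc m)))) (cong toℕ eq)
  0≡i : 0 ≡ toℕ i
  0≡i = trans (sym (trans (cong (_% suc m) si≡n) (n%n≡0 (suc m)))) toℕ-eq

private
  a-inj : ∀ {n} {i j : Fin n} → a i ≡ a j → i ≡ j
  a-inj refl = refl

  b-inj : ∀ {n} {i j : Fin n} → b i ≡ b j → i ≡ j
  b-inj refl = refl

  e-inj : ∀ {n} {i j : Fin n} → e i ≡ e j → i ≡ j
  e-inj refl = refl

UEdge-≢ : ∀ {n} → 2 ≤ n → {u v : UVertex n} → UEdge u v → u ≢ v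
UEdge-≢ 2≤n (aa i) eq = next-≢ 2≤n i (sym (a-inj eq))
UEdge-≢ 2≤n (bb i) eq = next-≢ 2≤n i (sym (b-inj eq))
UEdge-≢ 2≤n (ee i) eq = next-≢ 2≤n i (sym (e-inj eq))
UEdge-≢ 2≤n (ab i) ()
UEdge-≢ 2≤n (bc i) ()
UEdge-≢ 2≤n (cd i) ()
UEdge-≢ 2≤n (de i) ()
UEdge-≢ 2≤n (c⁺d i) ()

U : (n : ℕ) → 3 ≤ n → SimpleGraph
U n 3≤n = record
  { Vertex     = UVertex n
  ; Adj        = SymClosure UEdge
  ; Adj-sym    = symmetric UEdge
  ; Adj-irrefl = λ { (fwd p) → UEdge-≢ 2≤n p refl ; (bwd p) → UEdge-≢ 2≤n p refl }
  }
  where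
  2≤n : 2 ≤ n
  2≤n = ≤-trans (n≤1+n 2) 3≤n

{-# OPTIONS --safe #-}
module Submission where

-- A function that vanishes at w, changes by at most one along every edge, and
-- decreases along some edge at every vertex other than w is the distance to w;
-- hence all distances are read off from explicit formulas in the cyclic
-- distance M of the indices.  For n = 2j + 1 the pair {a₀, aⱼ} is locally
-- resolving, and for n = 2j + 2 with j ≥ 4 the pair {c₀, cⱼ}: along the cycle
-- the distances to 0 and to j change in opposite directions, except at the two
-- steps starting at j and at n - 1, where one of them leaves or reaches 0.  The cases
-- n = 4, 6, 8, where {c₀, cⱼ} fails, use a vertex d and are decided by
-- evaluation.  One vertex never suffices, since U_n contains a pentagon.

open import Defs
open import Data.Fin.Base as Fin using (Fin; toℕ; fromℕ; fromℕ<; inject₁)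
open import Data.Fin using (#_)
open import Data.Fin.Properties as Fin using (nonZeroIndex; toℕ<n; toℕ-fromℕ; toℕ-fromℕ<; toℕ-inject₁; toℕ-injective; all?)
open import Data.List.Base using (List; []; _∷_; length)
open import Data.List.Membership.Propositional using (_∈_)
open import Data.List.Relation.Unary.All using ([]; _∷_)
open import Data.List.Relation.Unary.Unique.Propositional using (Unique)
open import Data.List.Relation.Unary.AllPairs using ([]; _∷_)
open import Data.List.Relation.Unary.Any using (Any; any?; here; there; satisfied)
open import Data.Nat.Base using (ℕ; zero; suc; _+_; _∸_; _⊓_; ∣_-_∣; _≤_; _<_; z≤n; s≤s; z<s; parity)
open import Data.Nat.DivMod using (_%_; m%n<n; m<n⇒m%n≡m; n%n≡0)
open import Data.Nat.Properties
open import Data.Nat.Tactic.RingSolver using (solve-∀)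
open import Data.Parity.Base using (_⁻¹)
open import Data.Parity.Properties using (⁻¹-involutive; p≢p⁻¹; suc-homo-⁻¹)
open import Data.Product.Base using (Σ-syntax; ∃-syntax; _×_; _,_; proj₁; proj₂)
open import Data.Sum.Base as Sum using (_⊎_; inj₁; inj₂)
open import Data.Vec.Base using (Vec; []; _∷_; lookup)
open import Function.Base using (_∘_)
open import Relation.Binary.Construct.Closure.Symmetric using (SymClosure; fwd; bwd)
open import Relation.Binary.PropositionalEquality using (_≡_; _≢_; refl; sym; trans; cong; cong₂; subst; ≢-sym)
open import Relation.Nullary.Decidable using (Dec; yes; no; map′; _×-dec_; _⊎-dec_; ¬?; from-yes)
open import Relation.Nullary.Negation using (contradiction)

-- Natural numbers that differ by at most one.

data Near : ℕ → ℕ → Set where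
  same : ∀ {x} → Near x x
  up   : ∀ {x} → Near x (suc x)
  down : ∀ {x} → Near (suc x) x

Near-suc : ∀ {x y} → Near x y → Near (suc x) (suc y)
Near-suc same = same
Near-suc up   = up
Near-suc down = down

Near-sym : ∀ {x y} → Near x y → Near y x
Near-sym same = same
Near-sym up   = down
Near-sym down = up

Near⇒≤ : ∀ {x y} → Near x y → x ≤ suc y
Near⇒≤ same = n≤1+n _
Near⇒≤ up   = ≤-trans (n≤1+n _) (n≤1+n _)
Near⇒≤ down = ≤-refl

Near? : ∀ x y → Dec (Near x y)
Near? zero          zero          = yes same
Near? zero          (suc zero)    = yes up
Near? zero          (suc (suc y)) = no λ ()
Near? (suc zero)    zero          = yes down
Near? (suc (suc x)) zero          = no λ ()
Near? (suc x)       (suc y)       = map′ Near-suc Near-pred (Near? x y)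
  where
  Near-pred : ∀ {x y} → Near (suc x) (suc y) → Near x y
  Near-pred same = same
  Near-pred up   = up
  Near-pred down = down

≤∧≤⇒Near : ∀ {x y} → x ≤ suc y → y ≤ suc x → Near x y
≤∧≤⇒Near {zero}        {zero}        _       _       = same
≤∧≤⇒Near {zero}        {suc zero}    _       _       = up
≤∧≤⇒Near {zero}        {suc (suc y)} _       (s≤s ())
≤∧≤⇒Near {suc zero}    {zero}        _       _       = down
≤∧≤⇒Near {suc (suc x)} {zero}        (s≤s ()) _
≤∧≤⇒Near {suc x}       {suc y}       (s≤s p) (s≤s q) = Near-suc (≤∧≤⇒Near p q)

-- Distinct `Near` numbers are consecutive. This turns resolved edges into parity flips.
Near-parity : ∀ {x y} → Near x y → x ≢ y → parity y ≡ parity x ⁻¹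
Near-parity same x≢x = contradiction refl x≢x
Near-parity {x} up _ = trans (sym (⁻¹-involutive _)) (cong _⁻¹ (suc-homo-⁻¹ x))
Near-parity {y = y} down _ = sym (suc-homo-⁻¹ y)

-- Distances in a graph and certificates for them.

module _ (G : SimpleGraph) where
  open SimpleGraph G

  -- Prepending the edge to a shortest walk from the other endpoint bounds each distance by the
  -- other plus one.
  Distance-Near : ∀ {u v w k l} → Adj u v → Distance G u w k → Distance G v w l → Near k l
  Distance-Near u~v (p , k≤) (q , l≤) = ≤∧≤⇒Near (k≤ (cons u~v q)) (l≤ (cons (Adj-sym u~v) p))

  Distance-unique : ∀ {u w k l} → Distance G u w k → Distance G u w l → k ≡ l
  Distance-unique (p , k≤) (q , l≤) = ≤-antisym (k≤ q) (l≤ p)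

  -- A certificate that needs no search over walks: `origin` and `near` bound every walk from below,
  -- `descend` produces a walk attaining the bound.
  record IsDistanceTo (w : Vertex) (f : Vertex → ℕ) : Set where
    field
      origin  : f w ≡ 0
      near    : ∀ {u v} → Adj u v → Near (f u) (f v)
      descend : ∀ v → v ≡ w ⊎ ∃[ u ] (Adj v u × f v ≡ suc (f u))

    short : ∀ {u k} → Walk G u w k → f u ≤ k
    short nil        = ≤-reflexive origin
    short (cons p q) = ≤-trans (Near⇒≤ (near p)) (s≤s (short q))

    -- The recursion is on the value of `f`, which each descending edge lowers by one; at value zero
    -- `descend` leaves only `w`.
    walk : ∀ k u → f u ≡ k → Walk G u w k
    walk k u fu≡k with descend u
    walk zero    .w _  | inj₁ refl = nil
    walk (suc k) .w eq | inj₁ refl = contradiction (trans (sym eq) origin) λ ()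
    walk zero    u  eq | inj₂ (v , u~v , eq′) = contradiction (trans (sym eq) eq′) λ ()
    walk (suc k) u  eq | inj₂ (v , u~v , eq′) = cons u~v (walk k v (suc-injective (trans (sym eq′) eq)))

    distance : ∀ u → Distance G u w (f u)
    distance u = walk (f u) u refl , short

  open IsDistanceTo public

-- Reduction of the upper bound to two distance functions, and the lower bound.

ResolvingPair : (n : ℕ) → 3 ≤ n → Set
ResolvingPair n 3≤n = Σ[ W ∈ List (UVertex n) ] (Unique W × IsLocalResolvingSet (U n 3≤n) W × length W ≡ 2)

module _ {n : ℕ} (3≤n : 3 ≤ n) where

  onEdges : ∀ {f : UVertex n → ℕ} → (∀ {u v} → UEdge u v → Near (f u) (f v)) →
            ∀ {u v} → SymClosure UEdge u v → Near (f u) (f v)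
  onEdges h (fwd p) = h p
  onEdges h (bwd p) = Near-sym (h p)

  upperBound : ∀ {w w′ f g} → w ≢ w′ → IsDistanceTo (U n 3≤n) w f → IsDistanceTo (U n 3≤n) w′ g →
               (∀ {u v} → UEdge u v → f u ≢ f v ⊎ g u ≢ g v) → ResolvingPair n 3≤n
  upperBound {w} {w′} {f} {g} w≢w′ F G resolved = w ∷ w′ ∷ [] , ((w≢w′ ∷ []) ∷ [] ∷ []) , resolves , refl
    where
    resolvesEdge : ∀ {u v} → f u ≢ f v ⊎ g u ≢ g v → ∃[ x ] (x ∈ w ∷ w′ ∷ [] × Resolves (U n 3≤n) x u v)
    resolvesEdge (inj₁ ≢) = w  , here refl         , _ , _ , distance F _ , distance F _ , ≢
    resolvesEdge (inj₂ ≢) = w′ , there (here refl) , _ , _ , distance G _ , distance G _ , ≢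

    resolves : IsLocalResolvingSet (U n 3≤n) (w ∷ w′ ∷ [])
    resolves (fwd p) = resolvesEdge (resolved p)
    resolves (bwd p) = resolvesEdge (Sum.map ≢-sym ≢-sym (resolved p))

  -- A single vertex resolving all edges would alternate the parity of the
  -- distance around the pentagon bᵢ bᵢ₊₁ cᵢ₊₁ dᵢ cᵢ.
  lowerBound : ∀ W → Unique W → IsLocalResolvingSet (U n 3≤n) W → 2 ≤ length W
  lowerBound (_ ∷ _ ∷ _) _ _ = s≤s (s≤s z≤n)
  lowerBound [] _ lrs with () ← proj₁ (proj₂ (lrs (fwd (ab (fromℕ< 3≤n)))))
  lowerBound (w ∷ []) _ lrs = contradiction (proj₂ alternates) (p≢p⁻¹ _)
    where
    i : Fin n
    i = fromℕ< 3≤n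

    resolve : ∀ {u v} → SymClosure UEdge u v → Resolves (U n 3≤n) w u v
    resolve u~v with lrs u~v
    ... | _ , here refl , r = r

    flips : ∀ {u v k} → SymClosure UEdge u v → Distance (U n 3≤n) u w k →
            ∃[ l ] (Distance (U n 3≤n) v w l × parity l ≡ parity k ⁻¹)
    flips u~v D with resolve u~v
    ... | k′ , l , Du , Dv , k′≢l with refl ← Distance-unique (U n 3≤n) D Du =
      l , Dv , Near-parity (Distance-Near (U n 3≤n) u~v Du Dv) k′≢l

    -- That `b i` has a distance to `w` at all is read off from the resolution of an edge at `b i`.
    start : ∃[ k ] Distance (U n 3≤n) (b i) w k
    start with resolve (fwd (bb i))
    ... | k , _ , D , _ = k , D

    alternates : ∃[ p ] p ≡ p ⁻¹
    alternates with start
    ... | k , D₀ with flips (fwd (bb i)) D₀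
    ... | _ , D₁ , e₁ with flips (fwd (bc (next i))) D₁
    ... | _ , D₂ , e₂ with flips (fwd (c⁺d i)) D₂
    ... | _ , D₃ , e₃ with flips (bwd (cd i)) D₃
    ... | _ , D₄ , e₄ with flips (bwd (bc i)) D₄
    -- The fifth edge closes the pentagon at `b i`, so uniqueness of distance equates the first and
    -- last values, although an odd number of flips separates them.
    ... | _ , D₅ , e₅ with refl ← Distance-unique (U n 3≤n) D₀ D₅ = _ , five _ _ _ _ _ e₁ e₂ e₃ e₄ e₅
      where
      five : ∀ p₀ p₁ p₂ p₃ p₄ → p₁ ≡ p₀ ⁻¹ → p₂ ≡ p₁ ⁻¹ → p₃ ≡ p₂ ⁻¹ → p₄ ≡ p₃ ⁻¹ → p₀ ≡ p₄ ⁻¹ → p₀ ≡ p₀ ⁻¹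
      five p₀ _ _ _ _ refl refl refl refl eq = trans eq (trans (⁻¹-involutive _) (⁻¹-involutive _))

-- The index cycle: successor and distance.

module _ {n : ℕ} (i : Fin n) where
  private instance n≢0 = nonZeroIndex i

  toℕ-next : suc (toℕ i) < n → toℕ (next i) ≡ suc (toℕ i)
  toℕ-next i+1<n = trans (toℕ-fromℕ< (m%n<n (suc (toℕ i)) n)) (m<n⇒m%n≡m i+1<n)

  toℕ-next-last : suc (toℕ i) ≡ n → toℕ (next i) ≡ 0
  toℕ-next-last i+1≡n =
    trans (toℕ-fromℕ< (m%n<n (suc (toℕ i)) n)) (trans (cong (_% n) i+1≡n) (n%n≡0 n))

-- Only the last index has successor 0; all others have a positive successor, so the two kinds
-- cannot collide.
next-injective : ∀ {n} {i i′ : Fin n} → next i ≡ next i′ → i ≡ i′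
next-injective {i = i} {i′} eq with m≤n⇒m<n∨m≡n (toℕ<n i) | m≤n⇒m<n∨m≡n (toℕ<n i′)
... | inj₁ p | inj₁ q = toℕ-injective (suc-injective
  (trans (sym (toℕ-next i p)) (trans (cong toℕ eq) (toℕ-next i′ q))))
... | inj₁ p | inj₂ q = contradiction
  (trans (sym (toℕ-next i p)) (trans (cong toℕ eq) (toℕ-next-last i′ q))) λ ()
... | inj₂ p | inj₁ q = contradiction
  (trans (sym (toℕ-next i′ q)) (trans (cong toℕ (sym eq)) (toℕ-next-last i p))) λ ()
... | inj₂ p | inj₂ q = toℕ-injective (suc-injective (trans p (sym q)))

next-surjective-suc : ∀ {n k} (i : Fin n) → toℕ i ≡ suc k → ∃[ i′ ] (next i′ ≡ i × toℕ i′ ≡ k)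
next-surjective-suc {n} {k} i i≡1+k = i′ , toℕ-injective (trans (toℕ-next i′ 1+i′<n) (trans (cong suc i′≡k) (sym i≡1+k))) , i′≡k
  where
  1+k<n : suc k < n
  1+k<n = subst (_< n) i≡1+k (toℕ<n i)
  i′ : Fin n
  i′ = fromℕ< (≤-trans (n≤1+n _) 1+k<n)
  i′≡k : toℕ i′ ≡ k
  i′≡k = toℕ-fromℕ< _
  1+i′<n : suc (toℕ i′) < n
  1+i′<n = subst (λ x → suc x < n) (sym i′≡k) 1+k<n

-- The analogue of `IsDistanceTo` for the n-cycle, with the predecessor given as any `i′` whose
-- successor is `i`.
record IsCyclicDistanceTo {n : ℕ} (o : Fin n) (M : Fin n → ℕ) : Set where
  field
    centre : M o ≡ 0
    near   : ∀ i → Near (M i) (M (next i))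
    approach : ∀ i → i ≡ o ⊎ M i ≡ suc (M (next i)) ⊎ ∃[ i′ ] (next i′ ≡ i × M i ≡ suc (M i′))

-- Minima over consecutive indices, and the function `γ`.

data Drop (x : ℕ) : ℕ → Set where
  stay : Drop x x
  fall : ∀ {y} → x ≡ suc y → Drop x y

n⊓1+n≡n : ∀ n → n ⊓ suc n ≡ n
n⊓1+n≡n n = m≤n⇒m⊓n≡m (n≤1+n n)

1+n⊓n≡n : ∀ n → suc n ⊓ n ≡ n
1+n⊓n≡n n = m≥n⇒m⊓n≡n (n≤1+n n)

Near⇒Dropˡ : ∀ {x y} → Near x y → Drop x (x ⊓ y)
Near⇒Dropˡ {x} same rewrite ⊓-idem x = stay
Near⇒Dropˡ {x} up   rewrite n⊓1+n≡n x = stay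
Near⇒Dropˡ {y = y} down rewrite 1+n⊓n≡n y = fall refl

Near⇒Dropʳ : ∀ {x y} → Near x y → Drop y (x ⊓ y)
Near⇒Dropʳ {x} {y} x~y = subst (Drop y) (⊓-comm y x) (Near⇒Dropˡ (Near-sym x~y))

-- Both numbers lie in {x - 1, x}. For the minima of two consecutive index pairs, x is the value at
-- the shared index.
Drop⇒Near : ∀ {x y z} → Drop x y → Drop x z → Near y z
Drop⇒Near stay        stay        = same
Drop⇒Near stay        (fall refl) = down
Drop⇒Near (fall refl) stay        = up
Drop⇒Near (fall refl) (fall refl) = same

Drop⇒Near-suc : ∀ {x y} → Drop x y → Near x (suc y)
Drop⇒Near-suc stay        = up
Drop⇒Near-suc (fall refl) = same

-- The distance of cᵢ and cⱼ when i and j are at distance m in the n-cycle is γ m.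
γ : ℕ → ℕ
γ 0             = 0
γ 1             = 2
γ (suc (suc k)) = 4 + k

-- `γ` takes the values 0, 2, 4, 5, 6, ..., growing by 1 or 2 at each step, so γ x - γ y lies
-- between 0 and 2.
Drop⇒Near-γ : ∀ {x y} → Drop x y → Near (γ x) (suc (γ y))
Drop⇒Near-γ stay                          = up
Drop⇒Near-γ {y = 0}           (fall refl) = down
Drop⇒Near-γ {y = 1}           (fall refl) = down
Drop⇒Near-γ {y = suc (suc y)} (fall refl) = same

-- γ x is the minimum of 2x and x + 2: zigzag through the layers c and d, or detour along the
-- b-cycle.
Near-γ : ∀ x → Near (suc x) (γ x)
Near-γ 0             = down
Near-γ 1             = same
Near-γ (suc (suc x)) = up

-- Explicit distances to an a vertex and to a c vertex.

module _ {n : ℕ} (M : Fin n → ℕ) where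

  edgeMin : Fin n → ℕ
  edgeMin i = M i ⊓ M (next i)

  -- A shortest walk can run along the a-cycle and then straight across the layers. As `d i` is
  -- adjacent to `c i` and `c (next i)`, it is reached through the nearer one.
  distance-a : UVertex n → ℕ
  distance-a (a i) = M i
  distance-a (b i) = 1 + M i
  distance-a (c i) = 2 + M i
  distance-a (d i) = 3 + edgeMin i
  distance-a (e i) = 4 + edgeMin i

  -- The layers a and b are reached along the b-cycle, e along the e-cycle, and c and d by the
  -- cheaper route that `γ` measures.
  distance-c : UVertex n → ℕ
  distance-c (a i) = 2 + M i
  distance-c (b i) = 1 + M i
  distance-c (c i) = γ (M i)
  distance-c (d i) = 1 + γ (edgeMin i)
  distance-c (e i) = 2 + edgeMin i

module _ {n : ℕ} (3≤n : 3 ≤ n) {o : Fin n} {M : Fin n → ℕ} (cyclic : IsCyclicDistanceTo o M) where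
  open IsCyclicDistanceTo cyclic renaming (near to nearM)

  private
    q : Fin n → ℕ
    q = edgeMin M

  q-near : ∀ i → Near (q i) (q (next i))
  q-near i = Drop⇒Near (Near⇒Dropʳ (nearM i)) (Near⇒Dropˡ (nearM (next i)))

  isDistanceTo-a : IsDistanceTo (U n 3≤n) (a o) (distance-a M)
  isDistanceTo-a = record
    { origin  = centre
    ; near    = onEdges 3≤n {distance-a M} near′
    ; descend = descend′
    }
    where
    near′ : ∀ {u v} → UEdge u v → Near (distance-a M u) (distance-a M v)
    near′ (aa i)  = nearM i
    near′ (bb i)  = Near-suc (nearM i)
    near′ (ee i)  = Near-suc (Near-suc (Near-suc (Near-suc (q-near i))))
    near′ (ab i)  = up
    near′ (bc i)  = up
    near′ (cd i)  = Near-suc (Near-suc (Drop⇒Near-suc (Near⇒Dropˡ (nearM i))))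
    near′ (de i)  = up
    near′ (c⁺d i) = Near-suc (Near-suc (Drop⇒Near-suc (Near⇒Dropʳ (nearM i))))

    descend′ : ∀ v → v ≡ a o ⊎ ∃[ u ] (SymClosure UEdge v u × distance-a M v ≡ suc (distance-a M u))
    descend′ (a i) with approach i
    ... | inj₁ refl                     = inj₁ refl
    ... | inj₂ (inj₁ eq)                = inj₂ (_ , fwd (aa i) , eq)
    ... | inj₂ (inj₂ (i′ , refl , eq))  = inj₂ (_ , bwd (aa i′) , eq)
    descend′ (b i) = inj₂ (_ , bwd (ab i) , refl)
    descend′ (c i) = inj₂ (_ , bwd (bc i) , refl)
    descend′ (d i) with ⊓-sel (M i) (M (next i))
    ... | inj₁ eq = inj₂ (_ , bwd (cd i)  , cong (3 +_) eq)
    ... | inj₂ eq = inj₂ (_ , bwd (c⁺d i) , cong (3 +_) eq)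
    descend′ (e i) = inj₂ (_ , bwd (de i) , refl)

  -- The descent on the e-cycle: the smaller of `M i` and `M (next i)` must be lowered away from the
  -- other one, which gives the direction in which `q` falls.
  q-approach : ∀ i → q i ≡ 0 ⊎ q i ≡ suc (q (next i)) ⊎ ∃[ i′ ] (next i′ ≡ i × q i ≡ suc (q i′))
  q-approach i with ≤-total (M i) (M (next i))
  q-approach i | inj₁ x≤y with approach i
  ... | inj₁ refl = inj₁ (cong (_⊓ M (next i)) centre)
  ... | inj₂ (inj₁ x≡1+y) = contradiction (subst (_≤ M (next i)) x≡1+y x≤y) (<-irrefl refl)
  ... | inj₂ (inj₂ (i′ , refl , x≡1+w)) = inj₂ (inj₂ (i′ , refl ,
        trans (m≤n⇒m⊓n≡m x≤y) (trans x≡1+w (cong suc (sym (m≤n⇒m⊓n≡m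
          (≤-trans (n≤1+n _) (≤-reflexive (sym x≡1+w)))))))))
  q-approach i | inj₂ y≤x with approach (next i)
  ... | inj₁ eq = inj₁ (trans (m≥n⇒m⊓n≡n y≤x) (trans (cong M eq) centre))
  ... | inj₂ (inj₁ y≡1+z) = inj₂ (inj₁
        (trans (m≥n⇒m⊓n≡n y≤x) (trans y≡1+z (cong suc (sym (m≥n⇒m⊓n≡n
          (≤-trans (n≤1+n _) (≤-reflexive (sym y≡1+z)))))))))
  -- The predecessor of `next i` is `i`, whose value is not smaller in this case.
  ... | inj₂ (inj₂ (i′ , eq , y≡1+x)) with refl ← next-injective eq =
        contradiction (subst (_≤ M i) y≡1+x y≤x) (<-irrefl refl)

  isDistanceTo-c : IsDistanceTo (U n 3≤n) (c o) (distance-c M)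
  isDistanceTo-c = record
    { origin  = cong γ centre
    ; near    = onEdges 3≤n {distance-c M} near′
    ; descend = descend′
    }
    where
    near′ : ∀ {u v} → UEdge u v → Near (distance-c M u) (distance-c M v)
    near′ (aa i)  = Near-suc (Near-suc (nearM i))
    near′ (bb i)  = Near-suc (nearM i)
    near′ (ee i)  = Near-suc (Near-suc (q-near i))
    near′ (ab i)  = down
    near′ (bc i)  = Near-γ (M i)
    near′ (cd i)  = Drop⇒Near-γ (Near⇒Dropˡ (nearM i))
    near′ (de i)  = Near-suc (Near-sym (Near-γ (q i)))
    near′ (c⁺d i) = Drop⇒Near-γ (Near⇒Dropʳ (nearM i))

    descend′ : ∀ v → v ≡ c o ⊎ ∃[ u ] (SymClosure UEdge v u × distance-c M v ≡ suc (distance-c M u))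
    descend′ (a i) = inj₂ (_ , fwd (ab i) , refl)
    descend′ (b i) with approach i
    ... | inj₁ refl                    = inj₂ (_ , fwd (bc i) , cong suc (trans centre (sym (cong γ centre))))
    ... | inj₂ (inj₁ eq)               = inj₂ (_ , fwd (bb i) , cong suc eq)
    ... | inj₂ (inj₂ (i′ , refl , eq)) = inj₂ (_ , bwd (bb i′) , cong suc eq)
    descend′ (c i) with approach i
    ... | inj₁ refl = inj₁ refl
    ... | inj₂ (inj₁ eq) with M i in x≡ | M (next i) in y≡
    -- From index distance 2 on, the way leaves through `b i`; at distance 1 it is the two-edge
    -- route through the common d neighbour.
    ...   | suc (suc x) | _       = inj₂ (_ , bwd (bc i) , cong (2 +_) (sym x≡))
    ...   | suc zero    | zero    = inj₂ (_ , fwd (cd i) , cong (λ t → 2 + γ t) (sym (cong₂ _⊓_ x≡ y≡)))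
    ...   | suc zero    | suc _   = contradiction eq λ ()
    ...   | zero        | _       = contradiction eq λ ()
    descend′ (c i) | inj₂ (inj₂ (i′ , refl , eq)) with M (next i′) in x≡ | M i′ in y≡
    ...   | suc (suc x) | _       = inj₂ (_ , bwd (bc _) , cong (2 +_) (sym x≡))
    ...   | suc zero    | zero    = inj₂ (_ , fwd (c⁺d i′) , cong (λ t → 2 + γ t) (sym (cong₂ _⊓_ y≡ x≡)))
    ...   | suc zero    | suc _   = contradiction eq λ ()
    ...   | zero        | _       = contradiction eq λ ()
    descend′ (d i) with ⊓-sel (M i) (M (next i))
    ... | inj₁ eq = inj₂ (_ , bwd (cd i)  , cong (suc ∘ γ) eq)
    ... | inj₂ eq = inj₂ (_ , bwd (c⁺d i) , cong (suc ∘ γ) eq)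
    descend′ (e i) with q-approach i
    ... | inj₁ q≡0                     = inj₂ (_ , bwd (de i) , cong (2 +_) (trans q≡0 (sym (cong γ q≡0))))
    ... | inj₂ (inj₁ eq)               = inj₂ (_ , fwd (ee i) , cong (2 +_) eq)
    ... | inj₂ (inj₂ (i′ , refl , eq)) = inj₂ (_ , bwd (ee i′) , cong (2 +_) eq)

-- Inequalities that resolve single edges.

⊓-rise : ∀ {x y z} → x < y → y ≤ z → x ⊓ y ≢ y ⊓ z
⊓-rise x<y y≤z eq = <⇒≢ x<y (trans (sym (m≤n⇒m⊓n≡m (<⇒≤ x<y))) (trans eq (m≤n⇒m⊓n≡m y≤z)))

⊓-fall : ∀ {x y z} → y ≤ x → z < y → x ⊓ y ≢ y ⊓ z
⊓-fall y≤x z<y eq = <⇒≢ z<y (trans (sym (m≥n⇒m⊓n≡n (<⇒≤ z<y))) (trans (sym eq) (m≥n⇒m⊓n≡n y≤x)))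

-- Seen from an a vertex, an edge between c and d is unresolved only if its c end has the larger
-- index distance.
m≤n⇒m≢1+m⊓n : ∀ {m n} → m ≤ n → m ≢ 1 + m ⊓ n
m≤n⇒m≢1+m⊓n m≤n eq = 1+n≢n (sym (trans eq (cong suc (m≤n⇒m⊓n≡m m≤n))))

n≤m⇒n≢1+m⊓n : ∀ {m n} → n ≤ m → n ≢ 1 + m ⊓ n
n≤m⇒n≢1+m⊓n n≤m eq = 1+n≢n (sym (trans eq (cong suc (m≥n⇒m⊓n≡n n≤m))))

m≤n⇒γm≢1+γ[m⊓n] : ∀ {m n} → m ≤ n → γ m ≢ 1 + γ (m ⊓ n)
m≤n⇒γm≢1+γ[m⊓n] m≤n eq = 1+n≢n (sym (trans eq (cong (suc ∘ γ) (m≤n⇒m⊓n≡m m≤n))))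

n≤m⇒γn≢1+γ[m⊓n] : ∀ {m n} → n ≤ m → γ n ≢ 1 + γ (m ⊓ n)
n≤m⇒γn≢1+γ[m⊓n] n≤m eq = 1+n≢n (sym (trans eq (cong (suc ∘ γ) (m≥n⇒m⊓n≡n n≤m))))

-- Seen from a c vertex, the edges b-c and d-e are unresolved exactly when the index distance, or
-- the minimum for d-e, is 1.
1+n≢γn : ∀ {n} → n ≢ 1 → 1 + n ≢ γ n
1+n≢γn {0}           _   = λ ()
1+n≢γn {1}           1≢1 = contradiction refl 1≢1
1+n≢γn {suc (suc n)} _   = ≢-sym 1+n≢n

-- The distances to 0 and to the opposite index j, for n = 2j + 1 or 2j + 2.

module CyclicDistances (n j : ℕ) (1≤j : 1 ≤ j) (lo : suc (j + j) ≤ n) (hi : n ≤ 2 + (j + j)) where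

  -- As j lies in the middle of 0, ..., n - 1, passing from n - 1 to 0 never shortens a way to j, so
  -- `Mⱼ` is a plain difference.
  M₀ Mⱼ : Fin n → ℕ
  M₀ i = toℕ i ⊓ (n ∸ toℕ i)
  Mⱼ i = ∣ toℕ i - j ∣

  0<n : 0 < n
  0<n = ≤-trans z<s lo

  j<n : j < n
  j<n = ≤-trans (s≤s (m≤m+n j j)) lo

  -- Together with `≤j` this leaves s = j - 1 for odd n and s = j for even n.
  j≤1+ : ∀ {s} → 2 + (j + s) ≡ n → j ≤ suc s
  j≤1+ {s} refl = +-cancelˡ-≤ j j (suc s) (≤-trans (≤-pred lo) (≤-reflexive (sym (+-suc j s))))

  ≤j : ∀ {s} → 2 + (j + s) ≡ n → s ≤ j
  ≤j {s} refl = +-cancelˡ-≤ j s j (≤-pred (≤-pred hi))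

  module _ {i : Fin n} where

    M₀-left : ∀ {k} t → toℕ i ≡ k → k + t ≡ j → M₀ i ≡ k
    M₀-left t refl refl = m≤n⇒m⊓n≡m (m+n≤o⇒m≤o∸n k (≤-trans (+-mono-≤ (m≤m+n k t) (m≤m+n k t)) (≤-trans (n≤1+n _) lo)))
      where k = toℕ i

    Mⱼ-left : ∀ {k} t → toℕ i ≡ k → k + t ≡ j → Mⱼ i ≡ t
    Mⱼ-left {k} t refl refl = ∣m-m+n∣≡n k t

    M₀-right : ∀ s r → toℕ i ≡ suc (j + s) → 2 + (j + s) + r ≡ n → M₀ i ≡ suc r
    M₀-right s r i≡ n≡ = trans (cong₂ (λ x y → x ⊓ (y ∸ x)) i≡ (trans (sym n≡) (sym (+-suc (suc (j + s)) r))))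
      (trans (cong (suc (j + s) ⊓_) (m+n∸m≡n (suc (j + s)) (suc r))) (m≥n⇒m⊓n≡n (s≤s r≤j+s)))
      where
      r≤j+s : r ≤ j + s
      r≤j+s = ≤-trans (m≤n+m r s) (≤-trans (≤j (trans (cong (2 +_) (sym (+-assoc j s r))) n≡)) (m≤m+n j s))

    Mⱼ-right : ∀ s → toℕ i ≡ j + s → Mⱼ i ≡ s
    Mⱼ-right s i≡ = trans (cong ∣_- j ∣ i≡) (trans (∣-∣-comm (j + s) j) (∣m-m+n∣≡n j s))

    next-left : ∀ {k} t → toℕ i ≡ k → k + suc t ≡ j → toℕ (next i) ≡ suc k
    next-left {k} t refl refl = toℕ-next i (≤-trans (s≤s (≤-trans (m≤m+n (suc k) t) (≤-reflexive (sym (+-suc k t))))) j<n)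

    next-right : ∀ s r → toℕ i ≡ j + s → 2 + (j + s) + r ≡ n → toℕ (next i) ≡ suc (j + s)
    next-right s r i≡ n≡ = trans (toℕ-next i (subst (λ x → suc x < n) (sym i≡)
      (≤-trans (m≤m+n (2 + (j + s)) r) (≤-reflexive n≡)))) (cong suc i≡)

  -- Each constructor also stores the gap to j or to n - 1, so both distances become sums free of
  -- truncated subtraction: k and t on the left, 1 + r and 1 + s on the right.
  data Position (i : Fin n) : Set where
    left  : ∀ k t → toℕ i ≡ k → k + t ≡ j → Position i
    right : ∀ s r → toℕ i ≡ suc (j + s) → 2 + (j + s) + r ≡ n → Position i

  position : ∀ i → Position i
  position i with toℕ i ≤? j
  ... | yes i≤j = left (toℕ i) (j ∸ toℕ i) refl (m+[n∸m]≡n i≤j)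
  ... | no  i≰j = right (toℕ i ∸ suc j) (n ∸ suc (toℕ i)) (sym i≡)
        (trans (cong (λ x → suc x + (n ∸ suc (toℕ i))) i≡) (m+[n∸m]≡n (toℕ<n i)))
    where
    i≡ : suc j + (toℕ i ∸ suc j) ≡ toℕ i
    i≡ = m+[n∸m]≡n (≰⇒> i≰j)

  2+j≤n : 2 + j ≤ n
  2+j≤n = ≤-trans (s≤s (+-monoˡ-≤ j 1≤j)) lo

  shift-t : ∀ {k t} → k + suc t ≡ j → suc k + t ≡ j
  shift-t {k} {t} = trans (sym (+-suc k t))

  shift-i : ∀ {i s} → i ≡ suc (j + s) → i ≡ j + suc s
  shift-i {s = s} i≡ = trans i≡ (sym (+-suc j s))

  shift-s : ∀ {s r} → 2 + (j + s) + suc r ≡ n → 2 + (j + suc s) + r ≡ n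
  shift-s {s} {r} = trans (trans (cong (λ x → 2 + x + r) (+-suc j s)) (sym (+-suc (2 + (j + s)) r)))

  -- The arguments are M₀ i, Mⱼ i, M₀ (next i) and Mⱼ (next i).
  data Step : ℕ → ℕ → ℕ → ℕ → Set where
    rising  : ∀ k t → k + suc t ≡ j → Step k (suc t) (suc k) t
    peak    : ∀ {k} r → k ≡ j → 2 + (j + r) ≡ n → Step k 0 (suc r) 1
    falling : ∀ s r → 2 + (j + s) + suc r ≡ n → Step (2 + r) (1 + s) (1 + r) (2 + s)
    last    : ∀ s {k} → k ≡ j → 2 + (j + s) ≡ n → Step 1 (suc s) 0 k

  cast : ∀ {x x′ y y′ X X′ Y Y′} → X ≡ x → X′ ≡ x′ → Y ≡ y → Y′ ≡ y′ → Step x x′ y y′ → Step X X′ Y Y′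
  cast refl refl refl refl s = s

  step : ∀ i → Step (M₀ i) (Mⱼ i) (M₀ (next i)) (Mⱼ (next i))
  step i with position i
  ... | left k (suc t) i≡k k+1+t≡j
    = cast (M₀-left (suc t) i≡k k+1+t≡j) (Mⱼ-left (suc t) i≡k k+1+t≡j)
           (M₀-left t (next-left t i≡k k+1+t≡j) (shift-t k+1+t≡j))
           (Mⱼ-left t (next-left t i≡k k+1+t≡j) (shift-t k+1+t≡j)) (rising k t k+1+t≡j)
  -- Here the index is j; since j ≥ 1, `next i` is still below n and lies right of j.
  ... | left k zero i≡k k+0≡j
    = cast (M₀-left 0 i≡k k+0≡j) (Mⱼ-left 0 i≡k k+0≡j)
           (M₀-right 0 (n ∸ (2 + j)) next≡ n≡′) (Mⱼ-right 1 (shift-i next≡)) (peak (n ∸ (2 + j)) k≡j n≡)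
    where
    k≡j : k ≡ j
    k≡j = trans (sym (+-identityʳ k)) k+0≡j
    n≡ : 2 + j + (n ∸ (2 + j)) ≡ n
    n≡ = m+[n∸m]≡n 2+j≤n
    n≡′ : 2 + (j + 0) + (n ∸ (2 + j)) ≡ n
    n≡′ = trans (cong (λ x → 2 + x + (n ∸ (2 + j))) (+-identityʳ j)) n≡
    next≡ : toℕ (next i) ≡ suc (j + 0)
    next≡ = next-right 0 (n ∸ (2 + j)) (trans i≡k (trans k≡j (sym (+-identityʳ j)))) n≡′
  ... | right s (suc r) i≡ n≡
    = cast (M₀-right s (suc r) i≡ n≡) (Mⱼ-right (suc s) (shift-i i≡))
           (M₀-right (suc s) r (next-right (suc s) r (shift-i i≡) (shift-s n≡)) (shift-s n≡))
           (Mⱼ-right (2 + s) (shift-i (next-right (suc s) r (shift-i i≡) (shift-s n≡)))) (falling s r n≡)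
  ... | right s zero i≡ n≡
    = cast (M₀-right s 0 i≡ n≡) (Mⱼ-right (suc s) (shift-i i≡))
           (M₀-left j next≡ refl) (Mⱼ-left j next≡ refl) (last s refl n≡′)
    where
    n≡′ : 2 + (j + s) ≡ n
    n≡′ = trans (sym (+-identityʳ _)) n≡
    next≡ : toℕ (next i) ≡ 0
    next≡ = toℕ-next-last i (trans (cong suc i≡) n≡′)

  Step-near₀ : ∀ {x x′ y y′} → Step x x′ y y′ → Near x y
  Step-near₀ (rising k t _)     = up
  -- From j to 1 + r, where r is j - 1 or j: level for odd n, up by one for even n.
  Step-near₀ (peak r refl n≡)   = ≤∧≤⇒Near (≤-trans (j≤1+ n≡) (n≤1+n _)) (s≤s (≤j n≡))
  Step-near₀ (falling s r _)    = down
  Step-near₀ (last s _ _)       = down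

  Step-nearⱼ : ∀ {x x′ y y′} → Step x x′ y y′ → Near x′ y′
  Step-nearⱼ (rising k t _)     = down
  Step-nearⱼ (peak r _ n≡)      = up
  Step-nearⱼ (falling s r _)    = up
  Step-nearⱼ (last s refl n≡)   = ≤∧≤⇒Near (s≤s (≤j n≡)) (≤-trans (j≤1+ n≡) (n≤1+n _))

  o₀ oⱼ : Fin n
  o₀ = fromℕ< 0<n
  oⱼ = fromℕ< j<n

  o₀≢oⱼ : o₀ ≢ oⱼ
  o₀≢oⱼ eq = <⇒≢ 1≤j (trans (sym (toℕ-fromℕ< 0<n)) (trans (cong toℕ eq) (toℕ-fromℕ< j<n)))

  M₀-cyclic : IsCyclicDistanceTo o₀ M₀
  M₀-cyclic = record
    { centre   = M₀-left j (toℕ-fromℕ< 0<n) refl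
    ; near     = Step-near₀ ∘ step
    ; approach = approach
    }
    where
    approach : ∀ i → i ≡ o₀ ⊎ M₀ i ≡ suc (M₀ (next i)) ⊎ ∃[ i′ ] (next i′ ≡ i × M₀ i ≡ suc (M₀ i′))
    approach i with position i
    ... | left zero t i≡ _ = inj₁ (toℕ-injective (trans i≡ (sym (toℕ-fromℕ< 0<n))))
    ... | left (suc k) t i≡ k+t≡ with i′ , eq , i′≡k ← next-surjective-suc i i≡ =
      inj₂ (inj₂ (i′ , eq , trans (M₀-left t i≡ k+t≡)
        (cong suc (sym (M₀-left (suc t) i′≡k (trans (+-suc k t) k+t≡))))))
    ... | right s (suc r) i≡ n≡ = inj₂ (inj₁ (trans (M₀-right s (suc r) i≡ n≡)
      (cong suc (sym (M₀-right (suc s) r (next-right (suc s) r (shift-i i≡) (shift-s n≡)) (shift-s n≡))))))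
    ... | right s zero i≡ n≡ = inj₂ (inj₁ (trans (M₀-right s 0 i≡ n≡)
      (cong suc (sym (M₀-left j (toℕ-next-last i (trans (cong suc i≡) (trans (sym (+-identityʳ _)) n≡))) refl)))))

  Mⱼ-cyclic : IsCyclicDistanceTo oⱼ Mⱼ
  Mⱼ-cyclic = record
    { centre   = trans (cong ∣_- j ∣ (toℕ-fromℕ< j<n)) (∣n-n∣≡0 j)
    ; near     = Step-nearⱼ ∘ step
    ; approach = approach
    }
    where
    approach : ∀ i → i ≡ oⱼ ⊎ Mⱼ i ≡ suc (Mⱼ (next i)) ⊎ ∃[ i′ ] (next i′ ≡ i × Mⱼ i ≡ suc (Mⱼ i′))
    approach i with position i
    ... | left k zero i≡ k+0≡j = inj₁ (toℕ-injective
      (trans i≡ (trans (sym (+-identityʳ k)) (trans k+0≡j (sym (toℕ-fromℕ< j<n))))))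
    ... | left k (suc t) i≡ k+t≡ = inj₂ (inj₁ (trans (Mⱼ-left (suc t) i≡ k+t≡)
      (cong suc (sym (Mⱼ-left t (next-left t i≡ k+t≡) (shift-t k+t≡))))))
    ... | right s r i≡ n≡ with i′ , eq , i′≡ ← next-surjective-suc i i≡ =
      inj₂ (inj₂ (i′ , eq , trans (Mⱼ-right (suc s) (shift-i i≡)) (cong suc (sym (Mⱼ-right s i′≡)))))

  -- Every edge is resolved from one of the two centres.

  n≢j+j : ∀ {m} → m ≡ n → m ≢ j + j
  n≢j+j refl n≡j+j = <-irrefl (sym n≡j+j) lo

  -- `Step` forgets the index, so a direct change between `rising` and `falling` has to be excluded
  -- by arithmetic: the shared values would give n = 2j.
  rising⇏falling : ∀ {s r} → suc r + suc (suc s) ≡ j → 2 + (j + s) + suc r ≢ n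
  rising⇏falling {s} {r} p n≡ = n≢j+j n≡ (trans (rearrange j s r) (cong (j +_) p))
    where
    rearrange : ∀ j s r → 2 + (j + s) + suc r ≡ j + (suc r + suc (suc s))
    rearrange = solve-∀

  -- Distances on the e-cycle depend on minima over index pairs, so an e edge involves two
  -- consecutive steps. Where one centre's values run monotonically and the first rises strictly, or
  -- the last falls strictly, its minima differ.
  ee-resolved : ∀ {x x′ y y′ z z′} → Step x x′ y y′ → Step y y′ z z′ → x ⊓ y ≢ y ⊓ z ⊎ x′ ⊓ y′ ≢ y′ ⊓ z′
  ee-resolved (rising k _ _)     (rising _ _ _)    = inj₁ (⊓-rise ≤-refl (n≤1+n _))
  ee-resolved (rising k _ _)     (peak r refl n≡)  = inj₁ (⊓-rise ≤-refl (j≤1+ n≡))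
  ee-resolved (rising _ _ p)     (falling s r n≡)  = contradiction n≡ (rising⇏falling p)
  ee-resolved (rising _ _ p)     (last s _ n≡)     =
    contradiction (trans (rearrange j s) (cong (j +_) p)) (n≢j+j n≡)
    where
    rearrange : ∀ j s → 2 + (j + s) ≡ j + (2 + s)
    rearrange = solve-∀
  ee-resolved (peak r _ n≡)      (rising _ _ p)    =
    contradiction (trans (rearrange j r) (cong (j +_) p)) (n≢j+j n≡)
    where
    rearrange : ∀ j r → 2 + (j + r) ≡ j + (suc r + 1)
    rearrange = solve-∀
  ee-resolved (peak _ _ _)       (falling _ _ _)   = inj₂ λ ()
  -- This succession occurs only for j = 1 and n = 3, with a single index to the right of j.
  ee-resolved (peak _ _ _)       (last _ refl _)   = inj₂ (⊓-rise ≤-refl 1≤j)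
  ee-resolved (falling s r n≡)   (rising _ _ p)    = contradiction n≡ (rising⇏falling p)
  ee-resolved (falling s _ _)    (falling _ _ _)   = inj₂ (⊓-rise ≤-refl (n≤1+n _))
  ee-resolved (falling _ _ _)    (last _ _ _)      = inj₁ λ ()
  ee-resolved (last s refl n≡)   (rising _ _ _)    = inj₂ (⊓-fall (j≤1+ n≡) ≤-refl)
  ee-resolved (last _ _ _)       (peak _ refl _)   = contradiction 1≤j λ ()

  rim-resolved : ∀ {x x′ y y′} → Step x x′ y y′ → x ≢ y ⊎ x′ ≢ y′
  rim-resolved (rising _ _ _)  = inj₁ (≢-sym 1+n≢n)
  rim-resolved (peak _ _ _)    = inj₂ λ ()
  rim-resolved (falling _ _ _) = inj₁ 1+n≢n
  rim-resolved (last _ _ _)    = inj₁ λ ()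

  both : ∀ {x x′ y y′ : ℕ} → ∀ m → x ≢ y ⊎ x′ ≢ y′ → m + x ≢ m + y ⊎ m + x′ ≢ m + y′
  both m = Sum.map (_∘ +-cancelˡ-≡ m _ _) (_∘ +-cancelˡ-≡ m _ _)

  -- For c-d edges one centre must see the c end as the nearer index. Odd n ensures this at `peak`
  -- and `last`, where the other centre's distance stays level.
  distance-a-resolves : n ≤ suc (j + j) → ∀ {u v} → UEdge u v →
    distance-a M₀ u ≢ distance-a M₀ v ⊎ distance-a Mⱼ u ≢ distance-a Mⱼ v
  distance-a-resolves odd = resolved
    where
    1+≤j : ∀ {s} → 2 + (j + s) ≡ n → suc s ≤ j
    1+≤j {s} refl = +-cancelˡ-≤ j (suc s) j (≤-trans (≤-reflexive (+-suc j s)) (≤-pred odd))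

    cd-resolved : ∀ {x x′ y y′} → Step x x′ y y′ → x ≢ 1 + x ⊓ y ⊎ x′ ≢ 1 + x′ ⊓ y′
    cd-resolved (rising _ _ _)    = inj₁ (m≤n⇒m≢1+m⊓n (n≤1+n _))
    cd-resolved (peak _ _ _)      = inj₂ λ ()
    cd-resolved (falling _ _ _)   = inj₂ (m≤n⇒m≢1+m⊓n (n≤1+n _))
    cd-resolved (last _ refl n≡)  = inj₂ (m≤n⇒m≢1+m⊓n (1+≤j n≡))

    c⁺d-resolved : ∀ {x x′ y y′} → Step x x′ y y′ → y ≢ 1 + x ⊓ y ⊎ y′ ≢ 1 + x′ ⊓ y′
    c⁺d-resolved (rising _ _ _)    = inj₂ (n≤m⇒n≢1+m⊓n (n≤1+n _))
    c⁺d-resolved (peak _ refl n≡)  = inj₁ (n≤m⇒n≢1+m⊓n (1+≤j n≡))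
    c⁺d-resolved (falling _ _ _)   = inj₁ (n≤m⇒n≢1+m⊓n (n≤1+n _))
    c⁺d-resolved (last _ _ _)      = inj₁ λ ()

    resolved : ∀ {u v} → UEdge u v → distance-a M₀ u ≢ distance-a M₀ v ⊎ distance-a Mⱼ u ≢ distance-a Mⱼ v
    resolved (aa i)  = rim-resolved (step i)
    resolved (bb i)  = both 1 (rim-resolved (step i))
    resolved (ee i)  = both 4 (ee-resolved (step i) (step (next i)))
    resolved (ab i)  = inj₁ (≢-sym 1+n≢n)
    resolved (bc i)  = inj₁ (≢-sym 1+n≢n)
    resolved (cd i)  = both 2 (cd-resolved (step i))
    resolved (de i)  = inj₁ (≢-sym 1+n≢n)
    resolved (c⁺d i) = both 2 (c⁺d-resolved (step i))

  -- The jump from γ 0 = 0 to γ 1 = 2 resolves the c-d edges next to a centre for either parity of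
  -- n. An unresolved b-c or d-e edge would have the exceptional value 1 for both centres, which
  -- forces j ≤ 3.
  distance-c-resolves : 4 ≤ j → ∀ {u v} → UEdge u v →
    distance-c M₀ u ≢ distance-c M₀ v ⊎ distance-c Mⱼ u ≢ distance-c Mⱼ v
  distance-c-resolves 4≤j = resolved
    where
    bc-resolved : ∀ {x x′ y y′} → Step x x′ y y′ → 1 + x ≢ γ x ⊎ 1 + x′ ≢ γ x′
    -- An index at distance 1 from both 0 and j on this arc means j = 2.
    bc-resolved (rising 1 zero p)          = contradiction (subst (4 ≤_) (sym p) 4≤j) λ { (s≤s (s≤s ())) }
    bc-resolved (rising 1 (suc _) _)       = inj₂ (1+n≢γn λ ())
    bc-resolved (rising 0 _ _)             = inj₁ λ ()
    bc-resolved (rising (suc (suc _)) _ _) = inj₁ (1+n≢γn λ ())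
    bc-resolved (peak _ _ _)               = inj₂ λ ()
    bc-resolved (falling _ _ _)            = inj₁ (1+n≢γn λ ())
    bc-resolved (last zero _ n≡)           = contradiction (≤-trans 4≤j (j≤1+ n≡)) λ { (s≤s ()) }
    bc-resolved (last (suc _) _ n≡)        = inj₂ (1+n≢γn λ ())

    de-resolved : ∀ {x x′ y y′} → Step x x′ y y′ → γ (x ⊓ y) ≢ 1 + x ⊓ y ⊎ γ (x′ ⊓ y′) ≢ 1 + x′ ⊓ y′
    de-resolved (rising k t p) rewrite n⊓1+n≡n k | 1+n⊓n≡n t = helper k t p
      where
      helper : ∀ k t → k + suc t ≡ j → γ k ≢ 1 + k ⊎ γ t ≢ 1 + t
      -- Both minima equal 1 only for j = 3.
      helper 1 1             p = contradiction (subst (4 ≤_) (sym p) 4≤j) λ { (s≤s (s≤s (s≤s ()))) }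
      helper 1 0             p = inj₂ λ ()
      helper 1 (suc (suc t)) p = inj₂ (≢-sym (1+n≢γn λ ()))
      helper 0 _             p = inj₁ λ ()
      helper (suc (suc k)) _ p = inj₁ (≢-sym (1+n≢γn λ ()))
    de-resolved (peak _ _ _) = inj₂ λ ()
    de-resolved (falling s r n≡) rewrite n⊓1+n≡n s | 1+n⊓n≡n r = helper s r n≡
      where
      helper : ∀ s r → 2 + (j + s) + suc r ≡ n → γ (suc r) ≢ 2 + r ⊎ γ (suc s) ≢ 2 + s
      helper zero zero n≡    = contradiction
        (≤-trans 4≤j (j≤1+ (trans (rearrange j) n≡))) λ { (s≤s (s≤s ())) }
        where
        rearrange : ∀ j → 2 + (j + 1) ≡ 2 + (j + 0) + 1
        rearrange = solve-∀
      helper (suc s) _ n≡    = inj₂ (≢-sym (1+n≢γn λ ()))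
      helper zero (suc r) n≡ = inj₁ (≢-sym (1+n≢γn λ ()))
    de-resolved (last _ _ _) = inj₁ λ ()

    cd-resolved : ∀ {x x′ y y′} → Step x x′ y y′ → γ x ≢ 1 + γ (x ⊓ y) ⊎ γ x′ ≢ 1 + γ (x′ ⊓ y′)
    cd-resolved (rising k _ _)  = inj₁ (m≤n⇒γm≢1+γ[m⊓n] (n≤1+n k))
    cd-resolved (peak _ _ _)    = inj₂ λ ()
    cd-resolved (falling s _ _) = inj₂ (m≤n⇒γm≢1+γ[m⊓n] (n≤1+n (suc s)))
    cd-resolved (last _ _ _)    = inj₁ λ ()

    c⁺d-resolved : ∀ {x x′ y y′} → Step x x′ y y′ → γ y ≢ 1 + γ (x ⊓ y) ⊎ γ y′ ≢ 1 + γ (x′ ⊓ y′)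
    c⁺d-resolved (rising _ t _)  = inj₂ (n≤m⇒γn≢1+γ[m⊓n] (n≤1+n t))
    c⁺d-resolved (peak _ _ _)    = inj₂ λ ()
    c⁺d-resolved (falling _ r _) = inj₁ (n≤m⇒γn≢1+γ[m⊓n] (n≤1+n (suc r)))
    c⁺d-resolved (last _ _ _)    = inj₁ λ ()

    resolved : ∀ {u v} → UEdge u v → distance-c M₀ u ≢ distance-c M₀ v ⊎ distance-c Mⱼ u ≢ distance-c Mⱼ v
    resolved (aa i)  = both 2 (rim-resolved (step i))
    resolved (bb i)  = both 1 (rim-resolved (step i))
    resolved (ee i)  = both 2 (ee-resolved (step i) (step (next i)))
    resolved (ab i)  = inj₁ 1+n≢n
    resolved (bc i)  = bc-resolved (step i)
    resolved (cd i)  = cd-resolved (step i)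
    resolved (de i)  = both 1 (de-resolved (step i))
    resolved (c⁺d i) = c⁺d-resolved (step i)

-- Deciding distance certificates for a fixed n.

prev : ∀ {m} → Fin (suc m) → Fin (suc m)
prev {m} Fin.zero    = fromℕ m
prev     (Fin.suc i) = inject₁ i

next-prev : ∀ {m} (i : Fin (suc m)) → next (prev i) ≡ i
next-prev {m} Fin.zero        = toℕ-injective (toℕ-next-last (fromℕ m) (cong suc (toℕ-fromℕ m)))
next-prev {suc m} (Fin.suc i) = toℕ-injective (trans (toℕ-next (inject₁ i)
  (subst (λ x → suc x < 2 + m) (sym (toℕ-inject₁ i)) (s≤s (toℕ<n i)))) (cong suc (toℕ-inject₁ i)))

-- Listing all edges at `v` makes the existence of a descending edge a decidable `Any`; edges
-- involving the preceding index are transported along `next-prev`.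
neighbours : ∀ {m} (v : UVertex (suc m)) → List (∃[ u ] SymClosure UEdge v u)
neighbours (a i) = (_ , fwd (ab i)) ∷ (_ , fwd (aa i)) ∷
  (_ , bwd (subst (UEdge (a (prev i)) ∘ a) (next-prev i) (aa (prev i)))) ∷ []
neighbours (b i) = (_ , bwd (ab i)) ∷ (_ , fwd (bc i)) ∷ (_ , fwd (bb i)) ∷
  (_ , bwd (subst (UEdge (b (prev i)) ∘ b) (next-prev i) (bb (prev i)))) ∷ []
neighbours (c i) = (_ , bwd (bc i)) ∷ (_ , fwd (cd i)) ∷
  (_ , fwd (subst (λ x → UEdge (c x) (d (prev i))) (next-prev i) (c⁺d (prev i)))) ∷ []
neighbours (d i) = (_ , bwd (cd i)) ∷ (_ , bwd (c⁺d i)) ∷ (_ , fwd (de i)) ∷ []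
neighbours (e i) = (_ , bwd (de i)) ∷ (_ , fwd (ee i)) ∷
  (_ , bwd (subst (UEdge (e (prev i)) ∘ e) (next-prev i) (ee (prev i)))) ∷ []

allVertices? : ∀ {n} {P : UVertex n → Set} → (∀ v → Dec (P v)) → Dec (∀ v → P v)
allVertices? {P = P} P? =
  map′ to (λ p → p ∘ a , p ∘ b , p ∘ c , p ∘ d , p ∘ e)
    (all? (P? ∘ a) ×-dec all? (P? ∘ b) ×-dec all? (P? ∘ c) ×-dec all? (P? ∘ d) ×-dec all? (P? ∘ e))
  where
  to : (∀ i → P (a i)) × (∀ i → P (b i)) × (∀ i → P (c i)) × (∀ i → P (d i)) × (∀ i → P (e i)) → ∀ v → P v
  to (pa , _)              (a i) = pa i
  to (_ , pb , _)          (b i) = pb i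
  to (_ , _ , pc , _)      (c i) = pc i
  to (_ , _ , _ , pd , _)  (d i) = pd i
  to (_ , _ , _ , _ , pe)  (e i) = pe i

allEdges? : ∀ {n} {R : UVertex n → UVertex n → Set} → (∀ u v → Dec (R u v)) → Dec (∀ u v → UEdge u v → R u v)
allEdges? {n} {R} R? = map′ to
    (λ p → (λ i → p _ _ (aa i)) , (λ i → p _ _ (bb i)) , (λ i → p _ _ (ee i)) , (λ i → p _ _ (ab i)) ,
           (λ i → p _ _ (bc i)) , (λ i → p _ _ (cd i)) , (λ i → p _ _ (de i)) , (λ i → p _ _ (c⁺d i)))
    (all? (λ i → R? (a i) (a (next i))) ×-dec all? (λ i → R? (b i) (b (next i))) ×-dec
     all? (λ i → R? (e i) (e (next i))) ×-dec all? (λ i → R? (a i) (b i)) ×-dec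
     all? (λ i → R? (b i) (c i)) ×-dec all? (λ i → R? (c i) (d i)) ×-dec
     all? (λ i → R? (d i) (e i)) ×-dec all? (λ i → R? (c (next i)) (d i)))
  where
  to : (∀ i → R (a i) (a (next i))) × (∀ i → R (b i) (b (next i))) × (∀ i → R (e i) (e (next i))) ×
       (∀ i → R (a i) (b i)) × (∀ i → R (b i) (c i)) × (∀ i → R (c i) (d i)) × (∀ i → R (d i) (e i)) ×
       (∀ i → R (c (next i)) (d i)) → ∀ u v → UEdge u v → R u v
  to (p , _)                             _ _ (aa i)  = p i
  to (_ , p , _)                         _ _ (bb i)  = p i
  to (_ , _ , p , _)                     _ _ (ee i)  = p i
  to (_ , _ , _ , p , _)                 _ _ (ab i)  = p i
  to (_ , _ , _ , _ , p , _)             _ _ (bc i)  = p i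
  to (_ , _ , _ , _ , _ , p , _)         _ _ (cd i)  = p i
  to (_ , _ , _ , _ , _ , _ , p , _)     _ _ (de i)  = p i
  to (_ , _ , _ , _ , _ , _ , _ , p)     _ _ (c⁺d i) = p i

_≟d_ : ∀ {n} (v : UVertex n) (o : Fin n) → Dec (v ≡ d o)
a _ ≟d _ = no λ ()
b _ ≟d _ = no λ ()
c _ ≟d _ = no λ ()
d i ≟d o = map′ (cong d) (λ { refl → refl }) (i Fin.≟ o)
e _ ≟d _ = no λ ()

-- The decidable form of `IsDistanceTo` for a d vertex: oriented edges only, and descent sought
-- among the listed neighbours.
DistanceCertificate : ∀ {m} → Fin (suc m) → (UVertex (suc m) → ℕ) → Set
DistanceCertificate o f = f (d o) ≡ 0 × (∀ u v → UEdge u v → Near (f u) (f v)) ×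
  (∀ v → v ≡ d o ⊎ Any (λ u → f v ≡ suc (f (proj₁ u))) (neighbours v))

distanceCertificate? : ∀ {m} (o : Fin (suc m)) f → Dec (DistanceCertificate o f)
distanceCertificate? o f = f (d o) ≟ 0 ×-dec allEdges? (λ u v → Near? (f u) (f v)) ×-dec
  allVertices? (λ v → (v ≟d o) ⊎-dec any? (λ u → f v ≟ suc (f (proj₁ u))) (neighbours v))

certified⇒isDistanceTo : ∀ {m} (3≤n : 3 ≤ suc m) {o f} → DistanceCertificate o f → IsDistanceTo (U (suc m) 3≤n) (d o) f
certified⇒isDistanceTo 3≤n {o} {f} (f≡0 , nearf , descendf) = record
  { origin  = f≡0
  ; near    = onEdges 3≤n {f} (nearf _ _)
  ; descend = λ v → Sum.map₂ parent (descendf v)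
  }
  where
  parent : ∀ {v} → Any (λ u → f v ≡ suc (f (proj₁ u))) (neighbours v) →
           ∃[ u ] (SymClosure UEdge v u × f v ≡ suc (f u))
  parent p with (u , v~u) , eq ← satisfied p = u , v~u , eq

resolved? : ∀ {n} (f g : UVertex n → ℕ) → Dec (∀ u v → UEdge u v → f u ≢ f v ⊎ g u ≢ g v)
resolved? f g = allEdges? λ u v → ¬? (f u ≟ f v) ⊎-dec ¬? (g u ≟ g v)

-- The cases n = 4, 6, 8.

table : ∀ {n} (as bs cs ds es : Vec ℕ n) → UVertex n → ℕ
table as bs cs ds es (a i) = lookup as i
table as bs cs ds es (b i) = lookup bs i
table as bs cs ds es (c i) = lookup cs i
table as bs cs ds es (d i) = lookup ds i
table as bs cs ds es (e i) = lookup es i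

-- The pair is {a₀, d₀}, and the rows of `f` hold the distances to d₀, layer by layer.
pair₄ : ∀ 3≤4 → ResolvingPair 4 3≤4
pair₄ 3≤4 = upperBound 3≤4 (λ ()) (isDistanceTo-a 3≤4 M₀-cyclic)
    (certified⇒isDistanceTo 3≤4 (from-yes (distanceCertificate? (# 0) f)))
    (from-yes (resolved? (distance-a M₀) f) _ _)
  where
  open CyclicDistances 4 1 (from-yes (1 ≤? 1)) (from-yes (3 ≤? 4)) (from-yes (4 ≤? 4))
  f : UVertex 4 → ℕ
  f = table (3 ∷ 3 ∷ 4 ∷ 4 ∷ [])
            (2 ∷ 2 ∷ 3 ∷ 3 ∷ [])
            (1 ∷ 1 ∷ 3 ∷ 3 ∷ [])
            (0 ∷ 2 ∷ 4 ∷ 2 ∷ [])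
            (1 ∷ 2 ∷ 3 ∷ 2 ∷ [])

-- The pair is {c₀, d₄}; the same indices serve n = 8.
pair₆ : ∀ 3≤6 → ResolvingPair 6 3≤6
pair₆ 3≤6 = upperBound 3≤6 (λ ()) (isDistanceTo-c 3≤6 M₀-cyclic)
    (certified⇒isDistanceTo 3≤6 (from-yes (distanceCertificate? (# 4) f)))
    (from-yes (resolved? (distance-c M₀) f) _ _)
  where
  open CyclicDistances 6 2 (from-yes (1 ≤? 2)) (from-yes (5 ≤? 6)) (from-yes (6 ≤? 6))
  f : UVertex 6 → ℕ
  f = table (4 ∷ 5 ∷ 5 ∷ 4 ∷ 3 ∷ 3 ∷ [])
            (3 ∷ 4 ∷ 4 ∷ 3 ∷ 2 ∷ 2 ∷ [])
            (3 ∷ 5 ∷ 5 ∷ 3 ∷ 1 ∷ 1 ∷ [])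
            (4 ∷ 5 ∷ 4 ∷ 2 ∷ 0 ∷ 2 ∷ [])
            (3 ∷ 4 ∷ 3 ∷ 2 ∷ 1 ∷ 2 ∷ [])

pair₈ : ∀ 3≤8 → ResolvingPair 8 3≤8
pair₈ 3≤8 = upperBound 3≤8 (λ ()) (isDistanceTo-c 3≤8 M₀-cyclic)
    (certified⇒isDistanceTo 3≤8 (from-yes (distanceCertificate? (# 4) f)))
    (from-yes (resolved? (distance-c M₀) f) _ _)
  where
  open CyclicDistances 8 3 (from-yes (1 ≤? 3)) (from-yes (7 ≤? 8)) (from-yes (8 ≤? 8))
  f : UVertex 8 → ℕ
  f = table (6 ∷ 6 ∷ 5 ∷ 4 ∷ 3 ∷ 3 ∷ 4 ∷ 5 ∷ [])
            (5 ∷ 5 ∷ 4 ∷ 3 ∷ 2 ∷ 2 ∷ 3 ∷ 4 ∷ [])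
            (6 ∷ 6 ∷ 5 ∷ 3 ∷ 1 ∷ 1 ∷ 3 ∷ 5 ∷ [])
            (6 ∷ 5 ∷ 4 ∷ 2 ∷ 0 ∷ 2 ∷ 4 ∷ 5 ∷ [])
            (5 ∷ 4 ∷ 3 ∷ 2 ∷ 1 ∷ 2 ∷ 3 ∷ 4 ∷ [])

-- Odd n, even n from 10 on, and the case distinction on n.

odd-pair : ∀ j 3≤n → ResolvingPair (1 + (suc j + suc j)) 3≤n
odd-pair j 3≤n = upperBound 3≤n (o₀≢oⱼ ∘ a-injective)
    (isDistanceTo-a 3≤n M₀-cyclic) (isDistanceTo-a 3≤n Mⱼ-cyclic) (distance-a-resolves ≤-refl)
  where
  -- Opposite index `suc j` builds in positivity; j = 0 gives n = 3.
  open CyclicDistances _ (suc j) z<s ≤-refl (n≤1+n _)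
  a-injective : ∀ {n} {i i′ : Fin n} → a i ≡ a i′ → i ≡ i′
  a-injective refl = refl

even-pair : ∀ j → 4 ≤ j → ∀ 3≤n → ResolvingPair (2 + (j + j)) 3≤n
even-pair j 4≤j 3≤n = upperBound 3≤n (o₀≢oⱼ ∘ c-injective)
    (isDistanceTo-c 3≤n M₀-cyclic) (isDistanceTo-c 3≤n Mⱼ-cyclic) (distance-c-resolves 4≤j)
  where
  open CyclicDistances _ j (≤-trans (s≤s z≤n) 4≤j) (n≤1+n _) ≤-refl
  c-injective : ∀ {n} {i i′ : Fin n} → c i ≡ c i′ → i ≡ i′
  c-injective refl = refl

halve : ∀ n → ∃[ j ] (suc n ≡ 1 + (j + j) ⊎ suc n ≡ 2 + (j + j))
halve zero = 0 , inj₁ refl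
halve (suc n) with halve n
... | j , inj₁ eq = j , inj₂ (cong suc eq)
... | j , inj₂ eq = suc j , inj₁ (cong suc (trans eq (cong suc (sym (+-suc j j)))))

resolvingPair : ∀ n 3≤n → ResolvingPair n 3≤n
resolvingPair zero ()
resolvingPair (suc n) 3≤n with halve n
resolvingPair _ (s≤s ()) | 0 , inj₁ refl
resolvingPair _ 3≤n | suc j , inj₁ refl = odd-pair j 3≤n
resolvingPair _ (s≤s (s≤s ())) | 0 , inj₂ refl
resolvingPair _ 3≤n | 1 , inj₂ refl = pair₄ 3≤n
resolvingPair _ 3≤n | 2 , inj₂ refl = pair₆ 3≤n
resolvingPair _ 3≤n | 3 , inj₂ refl = pair₈ 3≤n
resolvingPair _ 3≤n | suc (suc (suc (suc j))) , inj₂ refl = even-pair (4 + j) (m≤m+n 4 j) 3≤n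

theorem4p1 : (n : ℕ) (3≤n : 3 ≤ n) → LocalMetricDimension (U n 3≤n) 2
theorem4p1 n 3≤n = resolvingPair n 3≤n , lowerBound 3≤n
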